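{- Let $\Gamma=\{I(1),P_{01}(1),P_{12}(1),N(1),X(1),X^T(1)\}$ be the set of basic $3\times 3$ permutation matrices. Let $f$ be any one of the nine 2-place ternary bent reference functions $f_1,\dots,f_9$ listed in the context, with sign representation $F$ and Vilenkin-Chrestenson spectrum $S_f$. Then there are 18 different permutation matrices of the form $P(2)=\alpha\otimes\beta$ with $\alpha,\beta\in\Gamma$ ($\alpha,\beta$ not necessarily different), each of which leads to a 2-place ternary function $g$ with $S_g=P(2)\,S_f$, the sign representation $G$ of $g$ being obtained as $G=W(2)\cdot F$ with $W(2)=3^{ -2}\,C(2)\cdot P(2)\cdot C^*(2)$; and the 18 functions $g$ obtained in this way are different.
   Context: Let $\xi=e^{2\pi i/3}$. An $n$-place ternary function is a map $f:\mathbb{Z}_3^n\to\mathbb{Z}_3$; $\oplus$ denotes addition modulo 3. Vectors indexed by $\mathbb{Z}_3^n$ are ordered by the integer $x=\sum_{i=1}^n x_i3^{n-i}$ ($x_1$ most significant). The value vector of $f$ is $[f(0),\dots,f(3^n-1)]^T$ and its sign representation is $F=[\xi^{f(0)},\dots,\xi^{f(3^n-1)}]^T$. A square matrix written $A(n)$ has size $3^n\times 3^n$; $I(n)$ is the identity. Let $C(1)=[\xi^{jk}]_{j,k\in\{0,1,2\}}$ and $C(n)=C(1)^{\otimes n}$ (Kronecker power); $C^*(n)$ is its entrywise complex conjugate. The Vilenkin-Chrestenson spectrum of (the sign representation of) $f$ is $S_f=C^*(n)\cdot F$, so that $F=3^{ -n}C(n)\cdot S_f$. The function $f$ is bent if every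 component of $S_f$ has absolute value $3^{n/2}$. The basic permutation matrices are $$P_{01}(1)=\begin{bmatrix}0&1&0\\1&0&0\\0&0&1\end{bmatrix},\quad P_{12}(1)=\begin{bmatrix}1&0&0\\0&0&1\\0&1&0\end{bmatrix},\quad N(1)=\begin{bmatrix}0&0&1\\0&1&0\\1&0&0\end{bmatrix},\quad X(1)=\begin{bmatrix}0&0&1\\1&0&0\\0&1&0\end{bmatrix},$$ $X^T(1)$ is the transpose of $X(1)$, and $I(1)$ is the $3\times3$ identity. The nine reference functions (all arithmetic modulo 3; value vectors in brackets) are: $f_1=x_1x_2$ $[000\,012\,021]$; $f_2=x_1x_2\oplus x_2\oplus 2x_2^2$ $[001\,010\,022]$; $f_3=x_1x_2\oplus x_1^2\oplus 2x_2\oplus 2$ $[210\,000\,012]$; $f_4=2x_1x_2\oplus 2x_1\oplus 2x_2^2\oplus 1$ $[100\,010\,220]$; $f_5=2x_1x_2\oplus 2x_1\oplus x_2^2\oplus 2$ $[200\,110\,020]$; $f_6=x_1x_2\oplus 2x_2\oplus 2x_1^2\oplus 1$ $[102\,000\,012]$; $f_7=x_1x_2\oplus x_1\oplus x_1^2$ $[000\,201\,021]$; $f_8=2x_1x_2\oplus x_1\oplus 2x_1^2$ $[000\,021\,120]$; $f_9=2x_1x_2\oplus x_2\oplus x_2^2$ $[020\,011\,002]$. -}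

module Defs where

open import Algebra.Bundles.Raw using (RawSemiring)
import Algebra.Definitions.RawSemiring as RawSemiringOps
open import Data.Fin.Base using (Fin; toℕ; finToFun; quotient; remainder)
open import Data.Fin.Patterns
open import Data.Fin.Properties using (all?)
open import Data.Integer.Base using (+_)
open import Data.List.Base as List using (List)
open import Data.Nat.Base as ℕ using (ℕ; zero; suc)
open import Data.Nat.DivMod using (_mod_)
open import Data.Product.Base using (_,_)
open import Data.Rational as ℚ using (ℚ; 0ℚ; 1ℚ)
open import Data.Vec.Base as Vec using (Vec)
open import Data.Vec.Functional using (Vector; []; _∷_; transpose)
open import Level using (0ℓ)
open import Relation.Binary.Definitions using (DecidableEquality)
open import Relation.Binary.PropositionalEquality using (_≡_; refl; cong₂; _≗_)
open import Relation.Nullary.Decidable using (Dec; map′; toWitness; _×-dec_)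

-- The subfield ℚ(ξ) of ℂ, ξ = e^{2πi/3}, which contains every number that
-- occurs here.  An element is written uniquely as a + b·ξ with a, b rational.
record ℚ⟨ξ⟩ : Set where
  constructor _+_·ξ
  field
    coeff₀ coeff₁ : ℚ

private
  infix 4 _≟_

  _≟_ : DecidableEquality ℚ⟨ξ⟩
  (a + b ·ξ) ≟ (c + d ·ξ) =
    map′ (λ (p , q) → cong₂ _+_·ξ p q)
         (λ { refl → refl , refl })
         (a ℚ.≟ c ×-dec b ℚ.≟ d)

infixl 6 _+_
infixl 7 _*_

_+_ : ℚ⟨ξ⟩ → ℚ⟨ξ⟩ → ℚ⟨ξ⟩
(a + b ·ξ) + (c + d ·ξ) = (a ℚ.+ c) + (b ℚ.+ d) ·ξ

-- ξ² = -1 - ξ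
_*_ : ℚ⟨ξ⟩ → ℚ⟨ξ⟩ → ℚ⟨ξ⟩
(a + b ·ξ) * (c + d ·ξ) =
  (a ℚ.* c ℚ.- b ℚ.* d) + (a ℚ.* d ℚ.+ b ℚ.* c ℚ.- b ℚ.* d) ·ξ

-- The complex conjugate of ξ is ξ² = -1 - ξ.
conj : ℚ⟨ξ⟩ → ℚ⟨ξ⟩
conj (a + b ·ξ) = (a ℚ.- b) + (ℚ.- b) ·ξ

fromℚ : ℚ → ℚ⟨ξ⟩
fromℚ q = q + 0ℚ ·ξ

0# 1# ξ ⅓ : ℚ⟨ξ⟩
0# = fromℚ 0ℚ
1# = fromℚ 1ℚ
ξ  = 0ℚ + 1ℚ ·ξ
⅓  = fromℚ (+ 1 ℚ./ 3)

ℚ⟨ξ⟩-rawSemiring : RawSemiring 0ℓ 0ℓ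
ℚ⟨ξ⟩-rawSemiring = record
  { Carrier = ℚ⟨ξ⟩ ; _≈_ = _≡_ ; _+_ = _+_ ; _*_ = _*_ ; 0# = 0# ; 1# = 1# }

open RawSemiringOps ℚ⟨ξ⟩-rawSemiring public using (sum; _^_)

Matrix : ℕ → Set
Matrix m = Vector (Vector ℚ⟨ξ⟩ m) m

infix  4 _≈ᴹ_
infixl 7 _·ᴹ_ _·ᵛ_ _⊗_

_≈ᴹ_ : ∀ {m} → Matrix m → Matrix m → Set
A ≈ᴹ B = ∀ i → A i ≗ B i

_·ᴹ_ : ∀ {m} → Matrix m → Matrix m → Matrix m
(A ·ᴹ B) i k = sum λ j → A i j * B j k

_·ᵛ_ : ∀ {m} → Matrix m → Vector ℚ⟨ξ⟩ m → Vector ℚ⟨ξ⟩ m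
(A ·ᵛ v) i = sum λ j → A i j * v j

_⊗_ : ∀ {m n} → Matrix m → Matrix n → Matrix (m ℕ.* n)
_⊗_ {m} {n} A B i j =
  A (quotient n i) (quotient n j) * B (remainder {m} n i) (remainder {m} n j)

_⊗^_ : ∀ {m} → Matrix m → (n : ℕ) → Matrix (m ℕ.^ n)
A ⊗^ zero  = λ _ _ → 1#
A ⊗^ suc n = A ⊗ (A ⊗^ n)

C₁ : Matrix 3
C₁ j k = ξ ^ (toℕ j ℕ.* toℕ k)

C C* : (n : ℕ) → Matrix (3 ℕ.^ n)
C  n     = C₁ ⊗^ n
C* n i j = conj (C n i j)

W : (n : ℕ) → Matrix (3 ℕ.^ n) → Matrix (3 ℕ.^ n)
W n P i j = ⅓ ^ n * (C n ·ᴹ P ·ᴹ C* n) i j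

ℤ₃ : Set
ℤ₃ = Fin 3

infixl 6 _⊕_
infixl 7 _⊙_

_⊕_ _⊙_ : ℤ₃ → ℤ₃ → ℤ₃
a ⊕ b = (toℕ a ℕ.+ toℕ b) mod 3
a ⊙ b = (toℕ a ℕ.* toℕ b) mod 3

TernaryFunction : ℕ → Set
TernaryFunction n = Vec ℤ₃ n → ℤ₃

-- `finToFun` lists base-3 digits most significant first, so the entry at
-- x = Σᵢ xᵢ 3ⁿ⁻ⁱ is f (x₁ , … , xₙ).
valueVector : ∀ {n} → TernaryFunction n → Vector ℤ₃ (3 ℕ.^ n)
valueVector f x = f (Vec.tabulate (finToFun x))

signRep : ∀ {n} → TernaryFunction n → Vector ℚ⟨ξ⟩ (3 ℕ.^ n)
signRep f x = ξ ^ toℕ (valueVector f x)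

spectrum : ∀ {n} → TernaryFunction n → Vector ℚ⟨ξ⟩ (3 ℕ.^ n)
spectrum {n} f = C* n ·ᵛ signRep f

-- |z| = 3^{n/2}, written as z z̄ = 3ⁿ.
Bent : ∀ {n} → TernaryFunction n → Set
Bent {n} f = ∀ w →
  spectrum f w * conj (spectrum f w) ≡ fromℚ (+ (3 ℕ.^ n) ℚ./ 1)

I₁ P₀₁ P₁₂ N₁ X₁ X₁ᵀ : Matrix 3
I₁  = (1# ∷ 0# ∷ 0# ∷ [])
    ∷ (0# ∷ 1# ∷ 0# ∷ [])
    ∷ (0# ∷ 0# ∷ 1# ∷ [])
    ∷ []
P₀₁ = (0# ∷ 1# ∷ 0# ∷ [])
    ∷ (1# ∷ 0# ∷ 0# ∷ [])
    ∷ (0# ∷ 0# ∷ 1# ∷ [])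
    ∷ []
P₁₂ = (1# ∷ 0# ∷ 0# ∷ [])
    ∷ (0# ∷ 0# ∷ 1# ∷ [])
    ∷ (0# ∷ 1# ∷ 0# ∷ [])
    ∷ []
N₁  = (0# ∷ 0# ∷ 1# ∷ [])
    ∷ (0# ∷ 1# ∷ 0# ∷ [])
    ∷ (1# ∷ 0# ∷ 0# ∷ [])
    ∷ []
X₁  = (0# ∷ 0# ∷ 1# ∷ [])
    ∷ (1# ∷ 0# ∷ 0# ∷ [])
    ∷ (0# ∷ 1# ∷ 0# ∷ [])
    ∷ []
X₁ᵀ = transpose X₁

Γ : List (Matrix 3)
Γ = I₁ List.∷ P₀₁ List.∷ P₁₂ List.∷ N₁ List.∷ X₁ List.∷ X₁ᵀ List.∷ List.[]

binary : (ℤ₃ → ℤ₃ → ℤ₃) → TernaryFunction 2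
binary h (x₁ Vec.∷ x₂ Vec.∷ Vec.[]) = h x₁ x₂

f₁ f₂ f₃ f₄ f₅ f₆ f₇ f₈ f₉ : TernaryFunction 2
f₁ = binary λ x₁ x₂ → x₁ ⊙ x₂
f₂ = binary λ x₁ x₂ → x₁ ⊙ x₂ ⊕ x₂ ⊕ 2F ⊙ (x₂ ⊙ x₂)
f₃ = binary λ x₁ x₂ → x₁ ⊙ x₂ ⊕ x₁ ⊙ x₁ ⊕ 2F ⊙ x₂ ⊕ 2F
f₄ = binary λ x₁ x₂ → 2F ⊙ x₁ ⊙ x₂ ⊕ 2F ⊙ x₁ ⊕ 2F ⊙ (x₂ ⊙ x₂) ⊕ 1F
f₅ = binary λ x₁ x₂ → 2F ⊙ x₁ ⊙ x₂ ⊕ 2F ⊙ x₁ ⊕ x₂ ⊙ x₂ ⊕ 2F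
f₆ = binary λ x₁ x₂ → x₁ ⊙ x₂ ⊕ 2F ⊙ x₂ ⊕ 2F ⊙ (x₁ ⊙ x₁) ⊕ 1F
f₇ = binary λ x₁ x₂ → x₁ ⊙ x₂ ⊕ x₁ ⊕ x₁ ⊙ x₁
f₈ = binary λ x₁ x₂ → 2F ⊙ x₁ ⊙ x₂ ⊕ x₁ ⊕ 2F ⊙ (x₁ ⊙ x₁)
f₉ = binary λ x₁ x₂ → 2F ⊙ x₁ ⊙ x₂ ⊕ x₂ ⊕ x₂ ⊙ x₂

reference : Vector (TernaryFunction 2) 9
reference = f₁ ∷ f₂ ∷ f₃ ∷ f₄ ∷ f₅ ∷ f₆ ∷ f₇ ∷ f₈ ∷ f₉ ∷ []

private
  values : TernaryFunction 2 → List ℕ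
  values f = List.map toℕ (List.tabulate (valueVector f))

  row : (a b c d e f g h i : ℕ) → List ℕ
  row a b c d e f g h i =
    a List.∷ b List.∷ c List.∷ d List.∷ e List.∷ f List.∷ g List.∷ h List.∷ i List.∷ List.[]

  values-f₁ : values f₁ ≡ row 0 0 0  0 1 2  0 2 1
  values-f₁ = refl
  values-f₂ : values f₂ ≡ row 0 0 1  0 1 0  0 2 2
  values-f₂ = refl
  values-f₃ : values f₃ ≡ row 2 1 0  0 0 0  0 1 2
  values-f₃ = refl
  values-f₄ : values f₄ ≡ row 1 0 0  0 1 0  2 2 0
  values-f₄ = refl
  values-f₅ : values f₅ ≡ row 2 0 0  1 1 0  0 2 0
  values-f₅ = refl
  values-f₆ : values f₆ ≡ row 1 0 2  0 0 0  0 1 2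
  values-f₆ = refl
  values-f₇ : values f₇ ≡ row 0 0 0  2 0 1  0 2 1
  values-f₇ = refl
  values-f₈ : values f₈ ≡ row 0 0 0  0 2 1  1 2 0
  values-f₈ = refl
  values-f₉ : values f₉ ≡ row 0 2 0  0 1 1  0 0 2
  values-f₉ = refl

  bent? : (f : TernaryFunction 2) → Dec (Bent f)
  bent? f = all? λ w →
    spectrum f w * conj (spectrum f w) ≟ fromℚ (+ 9 ℚ./ 1)

reference-bent : ∀ r → Bent (reference r)
reference-bent = toWitness {a? = all? λ r → bent? (reference r)} _

record LeadsTo {n} (P : Matrix (3 ℕ.^ n)) (f g : TernaryFunction n) : Set where
  field
    signRep-eq  : signRep g ≗ W n P ·ᵛ signRep f
    spectrum-eq : spectrum g ≗ P ·ᵛ spectrum f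

{-# OPTIONS --safe #-}

-- The elements of Γ act on ℤ₃ as the affine maps i ↦ εi + c with ε = ±1.  By
-- the substitution x ↦ (ε₁x₁ , ε₂x₂) in the defining sum of the spectrum,
-- permuting S_f by (i₁ , i₂) ↦ (ε₁i₁ + c₁ , ε₂i₂ + c₂) produces the spectrum of
--   g(x) = f(ε₁x₁ , ε₂x₂) ⊖ ε₁c₁x₁ ⊖ ε₂c₂x₂,
-- so all 36 products α ⊗ β lead to a function, whatever f is.  Since
-- f(⊖x₁ , ⊖x₂) differs from f(x₁ , x₂) by a linear function for quadratic f,
-- the products yield each g twice; requiring ε₂ = 1 leaves 18 different ones.
module Submission where

open import Defs
open import Relation.Binary.PropositionalEquality
open import Algebra.Bundles using (CommutativeSemiring)
open import Algebra.Definitions {A = ℚ⟨ξ⟩} _≡_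
open import Algebra.Structures {A = ℚ⟨ξ⟩} _≡_ using (IsCommutativeSemiring)
open import Algebra.Structures.Biased {A = ℚ⟨ξ⟩} _≡_ using (isCommutativeSemiringˡ)
open import Data.Bool.Base using (if_then_else_)
open import Data.Fin.Base using (Fin; zero; suc; toℕ; finToFun; funToFin; quotient; remainder)
open import Data.Fin.Patterns
open import Data.Fin.Permutation using (Permutation′; permutation)
open import Data.Fin.Properties using (all?; finToFun-funToFin) renaming (_≟_ to _≟ᶠ_)
import Data.List.Base as List
open import Data.List.Membership.Propositional using (_∈_)
open import Data.List.Membership.Propositional.Properties using (∈-lookup)
import Data.Nat.Base as ℕ
open import Data.Product.Base using (Σ-syntax; ∃-syntax; _×_; _,_)
open import Data.Rational as ℚ using (0ℚ; 1ℚ)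
import Data.Rational.Properties as ℚ
open import Data.Rational.Solver using (module +-*-Solver)
import Data.Vec.Base as Vec
open import Data.Vec.Functional using (Vector; []; _∷_)
open import Data.Vec.Properties using (tabulate-cong)
open import Function.Base using (_∘_)
open import Function.Definitions using (Injective)
open import Level using (0ℓ)
open import Relation.Binary.Definitions using (DecidableEquality)
open import Relation.Nullary.Decidable using (map′; toWitness; does; _×-dec_; _→-dec_)

open +-*-Solver using (solve; _:=_; _:+_; _:*_; _:-_; :-_; con)

-- Arithmetic of ℚ(ξ): decidable equality, ring laws, conjugation.

infix 4 _≟_

_≟_ : DecidableEquality ℚ⟨ξ⟩
(a + b ·ξ) ≟ (c + d ·ξ) =
  map′ (λ (p , q) → cong₂ _+_·ξ p q) (λ { refl → refl , refl })
       (a ℚ.≟ c ×-dec b ℚ.≟ d)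

+-assoc : Associative _+_
+-assoc (a + b ·ξ) (c + d ·ξ) (e + f ·ξ) =
  cong₂ _+_·ξ (ℚ.+-assoc a c e) (ℚ.+-assoc b d f)

+-comm : Commutative _+_
+-comm (a + b ·ξ) (c + d ·ξ) = cong₂ _+_·ξ (ℚ.+-comm a c) (ℚ.+-comm b d)

+-identityˡ : LeftIdentity 0# _+_
+-identityˡ (a + b ·ξ) = cong₂ _+_·ξ (ℚ.+-identityˡ a) (ℚ.+-identityˡ b)

+-identityʳ : RightIdentity 0# _+_
+-identityʳ x = trans (+-comm x 0#) (+-identityˡ x)

*-assoc : Associative _*_
*-assoc (a + b ·ξ) (c + d ·ξ) (e + f ·ξ) = cong₂ _+_·ξ
  (solve 6 (λ a b c d e f →
     (a :* c :- b :* d) :* e :- (a :* d :+ b :* c :- b :* d) :* f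
     := a :* (c :* e :- d :* f) :- b :* (c :* f :+ d :* e :- d :* f))
   refl a b c d e f)
  (solve 6 (λ a b c d e f →
     (a :* c :- b :* d) :* f :+ (a :* d :+ b :* c :- b :* d) :* e
       :- (a :* d :+ b :* c :- b :* d) :* f
     := a :* (c :* f :+ d :* e :- d :* f) :+ b :* (c :* e :- d :* f)
       :- b :* (c :* f :+ d :* e :- d :* f))
   refl a b c d e f)

*-comm : Commutative _*_
*-comm (a + b ·ξ) (c + d ·ξ) = cong₂ _+_·ξ
  (solve 4 (λ a b c d → a :* c :- b :* d := c :* a :- d :* b) refl a b c d)
  (solve 4 (λ a b c d →
     a :* d :+ b :* c :- b :* d := c :* b :+ d :* a :- d :* b) refl a b c d)

*-identityˡ : LeftIdentity 1# _*_
*-identityˡ (a + b ·ξ) = cong₂ _+_·ξ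
  (solve 2 (λ a b → con 1ℚ :* a :- con 0ℚ :* b := a) refl a b)
  (solve 2 (λ a b → con 1ℚ :* b :+ con 0ℚ :* a :- con 0ℚ :* b := b) refl a b)

*-identityʳ : RightIdentity 1# _*_
*-identityʳ x = trans (*-comm x 1#) (*-identityˡ x)

*-distribʳ-+ : _*_ DistributesOverʳ _+_
*-distribʳ-+ (a + b ·ξ) (c + d ·ξ) (e + f ·ξ) = cong₂ _+_·ξ
  (solve 6 (λ a b c d e f →
     (c :+ e) :* a :- (d :+ f) :* b
     := (c :* a :- d :* b) :+ (e :* a :- f :* b))
   refl a b c d e f)
  (solve 6 (λ a b c d e f →
     (c :+ e) :* b :+ (d :+ f) :* a :- (d :+ f) :* b
     := (c :* b :+ d :* a :- d :* b) :+ (e :* b :+ f :* a :- f :* b))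
   refl a b c d e f)

*-zeroˡ : LeftZero 0# _*_
*-zeroˡ (a + b ·ξ) = cong₂ _+_·ξ
  (solve 2 (λ a b → con 0ℚ :* a :- con 0ℚ :* b := con 0ℚ) refl a b)
  (solve 2 (λ a b → con 0ℚ :* b :+ con 0ℚ :* a :- con 0ℚ :* b := con 0ℚ) refl a b)

-- Lets the conjugate of a character of ℤ₃² be split into one factor per coordinate.
conj-* : ∀ x y → conj (x * y) ≡ conj x * conj y
conj-* (a + b ·ξ) (c + d ·ξ) = cong₂ _+_·ξ
  (solve 4 (λ a b c d →
     (a :* c :- b :* d) :- (a :* d :+ b :* c :- b :* d)
     := (a :- b) :* (c :- d) :- (:- b) :* (:- d))
   refl a b c d)
  (solve 4 (λ a b c d →
     :- (a :* d :+ b :* c :- b :* d)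
     := (a :- b) :* (:- d) :+ (:- b) :* (c :- d) :- (:- b) :* (:- d))
   refl a b c d)

-- Opens up the laws of finite sums: interchange, reindexing by a permutation, distributivity.
+-*-isCommutativeSemiring : IsCommutativeSemiring _+_ _*_ 0# 1#
+-*-isCommutativeSemiring = isCommutativeSemiringˡ record
  { +-isCommutativeMonoid = record
    { isMonoid = record
      { isSemigroup = record
        { isMagma = record { isEquivalence = isEquivalence ; ∙-cong = cong₂ _+_ }
        ; assoc = +-assoc }
      ; identity = +-identityˡ , +-identityʳ }
    ; comm = +-comm }
  ; *-isCommutativeMonoid = record
    { isMonoid = record
      { isSemigroup = record
        { isMagma = record { isEquivalence = isEquivalence ; ∙-cong = cong₂ _*_ }
        ; assoc = *-assoc }
      ; identity = *-identityˡ , *-identityʳ }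
    ; comm = *-comm }
  ; distribʳ = *-distribʳ-+
  ; zeroˡ = *-zeroˡ
  }

+-*-commutativeSemiring : CommutativeSemiring 0ℓ 0ℓ
+-*-commutativeSemiring = record { isCommutativeSemiring = +-*-isCommutativeSemiring }

open CommutativeSemiring +-*-commutativeSemiring using (semiring; *-commutativeSemigroup)
open import Algebra.Properties.CommutativeSemigroup *-commutativeSemigroup using (x∙yz≈y∙xz)
open import Algebra.Properties.Semiring.Sum semiring
  using (sum-cong-≗; ∑-comm; ∑-permute; *-distribˡ-sum; *-distribʳ-sum)

open ≡-Reasoning

-- Matrices acting on vectors.

·ᵛ-congˡ : ∀ {m} (A : Matrix m) {u v : Vector ℚ⟨ξ⟩ m} → u ≗ v → A ·ᵛ u ≗ A ·ᵛ v
·ᵛ-congˡ A u≗v i = sum-cong-≗ λ j → cong (A i j *_) (u≗v j)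

·ᵛ-congʳ : ∀ {m} {A B : Matrix m} → A ≈ᴹ B → (v : Vector ℚ⟨ξ⟩ m) → A ·ᵛ v ≗ B ·ᵛ v
·ᵛ-congʳ A≈B v i = sum-cong-≗ λ j → cong (_* v j) (A≈B i j)

·ᴹ-·ᵛ-assoc : ∀ {m} (A B : Matrix m) v → (A ·ᴹ B) ·ᵛ v ≗ A ·ᵛ (B ·ᵛ v)
·ᴹ-·ᵛ-assoc A B v i = begin
  sum (λ k → sum (λ j → A i j * B j k) * v k)
    ≡⟨ sum-cong-≗ (λ k → *-distribʳ-sum (v k) (λ j → A i j * B j k)) ⟩
  sum (λ k → sum (λ j → A i j * B j k * v k))
    ≡⟨ ∑-comm (λ k j → A i j * B j k * v k) ⟩
  sum (λ j → sum (λ k → A i j * B j k * v k))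
    ≡⟨ sum-cong-≗ (λ j → sum-cong-≗ λ k → *-assoc (A i j) (B j k) (v k)) ⟩
  sum (λ j → sum (λ k → A i j * (B j k * v k)))
    ≡⟨ sum-cong-≗ (λ j → *-distribˡ-sum (A i j) (λ k → B j k * v k)) ⟨
  sum (λ j → A i j * sum (λ k → B j k * v k)) ∎

·ᵛ-scale : ∀ {m} t (A : Matrix m) v →
           (λ i j → t * A i j) ·ᵛ v ≗ λ i → t * (A ·ᵛ v) i
·ᵛ-scale t A v i = begin
  sum (λ j → t * A i j * v j)    ≡⟨ sum-cong-≗ (λ j → *-assoc t (A i j) (v j)) ⟩
  sum (λ j → t * (A i j * v j))  ≡⟨ *-distribˡ-sum t (λ j → A i j * v j) ⟨
  t * sum (λ j → A i j * v j)    ∎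

-- Permutation matrices.

permutationMatrix : ∀ {m} → (Fin m → Fin m) → Matrix m
permutationMatrix σ i j = if does (σ i ≟ᶠ j) then 1# else 0#

sum-zero-multiples : ∀ {m} (v : Vector ℚ⟨ξ⟩ m) → sum (λ j → 0# * v j) ≡ 0#
sum-zero-multiples v = trans (sym (*-distribˡ-sum 0# v)) (*-zeroˡ (sum v))

sum-select : ∀ {m} (k : Fin m) (v : Vector ℚ⟨ξ⟩ m) →
             sum (λ j → (if does (k ≟ᶠ j) then 1# else 0#) * v j) ≡ v k
sum-select zero    v = begin
  1# * v zero + sum (λ j → 0# * v (suc j))
    ≡⟨ cong₂ _+_ (*-identityˡ (v zero)) (sum-zero-multiples (v ∘ suc)) ⟩
  v zero + 0#
    ≡⟨ +-identityʳ (v zero) ⟩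
  v zero ∎
-- `does (suc k ≟ᶠ suc j)` reduces to `does (k ≟ᶠ j)`, so the tail of the sum is an instance of the
-- induction hypothesis.
sum-select (suc k) v = begin
  0# * v zero + sum (λ j → (if does (k ≟ᶠ j) then 1# else 0#) * v (suc j))
    ≡⟨ cong₂ _+_ (*-zeroˡ (v zero)) (sum-select k (v ∘ suc)) ⟩
  0# + v (suc k)
    ≡⟨ +-identityˡ (v (suc k)) ⟩
  v (suc k) ∎

permutationMatrix-·ᵛ : ∀ {m} (σ : Fin m → Fin m) (v : Vector ℚ⟨ξ⟩ m) →
                        permutationMatrix σ ·ᵛ v ≗ v ∘ σ
permutationMatrix-·ᵛ σ v i = sum-select (σ i) v

-- Inversion of the Vilenkin-Chrestenson transform.

-- Orthogonality of the characters of ℤ₃², checked on all 81 entries. Writing the identity matrix as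
-- a permutation matrix lets `permutationMatrix-·ᵛ` remove it.
C·C*-inverse : ∀ i j → ⅓ ^ 2 * (C 2 ·ᴹ C* 2) i j ≡ permutationMatrix (λ x → x) i j
C·C*-inverse = toWitness {a? = all? λ i → all? λ j → _ ≟ _} _

inversion : ∀ (v : Vector ℚ⟨ξ⟩ 9) i → ⅓ ^ 2 * (C 2 ·ᵛ (C* 2 ·ᵛ v)) i ≡ v i
inversion v i = begin
  ⅓ ^ 2 * (C 2 ·ᵛ (C* 2 ·ᵛ v)) i
    ≡⟨ cong (⅓ ^ 2 *_) (·ᴹ-·ᵛ-assoc (C 2) (C* 2) v i) ⟨
  ⅓ ^ 2 * ((C 2 ·ᴹ C* 2) ·ᵛ v) i
    ≡⟨ ·ᵛ-scale (⅓ ^ 2) (C 2 ·ᴹ C* 2) v i ⟨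
  ((λ i j → ⅓ ^ 2 * (C 2 ·ᴹ C* 2) i j) ·ᵛ v) i
    ≡⟨ ·ᵛ-congʳ C·C*-inverse v i ⟩
  (permutationMatrix (λ x → x) ·ᵛ v) i
    ≡⟨ permutationMatrix-·ᵛ (λ x → x) v i ⟩
  v i ∎

-- Up to the scalar, `W n P` transforms, applies `P` to the spectrum, and transforms back.
W-·ᵛ : ∀ n (P : Matrix (3 ℕ.^ n)) v →
       W n P ·ᵛ v ≗ λ i → ⅓ ^ n * (C n ·ᵛ (P ·ᵛ (C* n ·ᵛ v))) i
W-·ᵛ n P v i = begin
  (W n P ·ᵛ v) i
    ≡⟨ ·ᵛ-scale (⅓ ^ n) (C n ·ᴹ P ·ᴹ C* n) v i ⟩
  ⅓ ^ n * ((C n ·ᴹ P ·ᴹ C* n) ·ᵛ v) i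
    ≡⟨ cong (⅓ ^ n *_) (·ᴹ-·ᵛ-assoc (C n ·ᴹ P) (C* n) v i) ⟩
  ⅓ ^ n * ((C n ·ᴹ P) ·ᵛ (C* n ·ᵛ v)) i
    ≡⟨ cong (⅓ ^ n *_) (·ᴹ-·ᵛ-assoc (C n) P (C* n ·ᵛ v) i) ⟩
  ⅓ ^ n * (C n ·ᵛ (P ·ᵛ (C* n ·ᵛ v))) i ∎

-- A function's sign representation is recovered from its spectrum by inversion, so only spectra
-- have to be compared from here on.
spectrum-eq⇒leadsTo : ∀ {P} {f g : TernaryFunction 2} →
                      spectrum g ≗ P ·ᵛ spectrum f → LeadsTo P f g
spectrum-eq⇒leadsTo {P} {f} {g} Sg≗PSf = record
  { signRep-eq = λ i → begin
      signRep g i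
        ≡⟨ inversion (signRep g) i ⟨
      ⅓ ^ 2 * (C 2 ·ᵛ spectrum g) i
        ≡⟨ cong (⅓ ^ 2 *_) (·ᵛ-congˡ (C 2) Sg≗PSf i) ⟩
      ⅓ ^ 2 * (C 2 ·ᵛ (P ·ᵛ spectrum f)) i
        ≡⟨ W-·ᵛ 2 P (signRep f) i ⟨
      (W 2 P ·ᵛ signRep f) i ∎
  ; spectrum-eq = Sg≗PSf
  }

-- The affine action of Γ on indices.

γ : Vector (Matrix 3) 6
γ = List.lookup Γ

-- The coefficients ε and c, in the order in which `Γ` lists its elements; ε = -1 is stored as `2F`.
slope shift : Vector ℤ₃ 6
slope = 1F ∷ 2F ∷ 2F ∷ 2F ∷ 1F ∷ 1F ∷ []
shift = 0F ∷ 1F ∷ 0F ∷ 2F ∷ 2F ∷ 1F ∷ []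

digit : Fin 9 → Vector ℤ₃ 2
digit = finToFun

-- Since `2F` is -1, `linear a x` is the correction ⊖εcx.
affine linear : Fin 6 → ℤ₃ → ℤ₃
affine a i = slope a ⊙ i ⊕ shift a
linear a x = 2F ⊙ slope a ⊙ shift a ⊙ x

-- `affines` moves the index of the spectrum; `slopes` is the substitution in the summation
-- variable.
affines slopes : Fin 6 → Fin 6 → Fin 9 → Fin 9
affines a b i = funToFin (affine a (digit i 0F) ∷ affine b (digit i 1F) ∷ [])
slopes a b x = funToFin (slope a ⊙ digit x 0F ∷ slope b ⊙ digit x 1F ∷ [])

γ⊗γ-isPermutation : ∀ a b → γ a ⊗ γ b ≈ᴹ permutationMatrix (affines a b)
γ⊗γ-isPermutation = toWitness
  {a? = all? λ a → all? λ b → all? λ i → all? λ j → _ ≟ _} _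

-- From ε² = 1; this makes the substitution a bijection, by which a sum may be reindexed.
slopes-involutive : ∀ a b x → slopes a b (slopes a b x) ≡ x
slopes-involutive = toWitness {a? = all? λ a → all? λ b → all? λ x → _ ≟ᶠ _} _

slopesPermutation : Fin 6 → Fin 6 → Permutation′ 9
slopesPermutation a b = permutation (slopes a b) (slopes a b)
  (slopes-involutive a b) (slopes-involutive a b)

-- The spectrum of the transformed function.

transform : Fin 6 → Fin 6 → TernaryFunction 2 → TernaryFunction 2
transform a b f = binary λ x₁ x₂ →
  f (slope a ⊙ x₁ Vec.∷ slope b ⊙ x₂ Vec.∷ Vec.[]) ⊕ linear a x₁ ⊕ linear b x₂

-- For ε = ±1: t - εcx - ix = t - (εi + c)(εx).
character-affine : ∀ a i x t →
  conj (C₁ i x) * ξ ^ toℕ (t ⊕ linear a x) ≡ conj (C₁ (affine a i) (slope a ⊙ x)) * ξ ^ toℕ t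
character-affine = toWitness
  {a? = all? λ a → all? λ i → all? λ x → all? λ t → _ ≟ _} _

-- The factor `z` is carried along to nest the product to the right, so that `character-affine` can
-- be applied to the innermost pair.
C*-* : ∀ i x z → C* 2 i x * z ≡
  conj (C₁ (digit i 0F) (digit x 0F)) * (conj (C₁ (digit i 1F) (digit x 1F)) * z)
C*-* i x z = begin
  -- The `1#` is the empty Kronecker power that ends the recursion of `⊗^`.
  conj (c₀ * (c₁ * 1#)) * z    ≡⟨ cong (λ y → conj (c₀ * y) * z) (*-identityʳ c₁) ⟩
  conj (c₀ * c₁) * z           ≡⟨ cong (_* z) (conj-* c₀ c₁) ⟩
  conj c₀ * conj c₁ * z        ≡⟨ *-assoc (conj c₀) (conj c₁) z ⟩
  conj c₀ * (conj c₁ * z)      ∎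
  where
  c₀ = C₁ (digit i 0F) (digit x 0F)
  c₁ = C₁ (digit i 1F) (digit x 1F)

signRep-slopes : ∀ a b f x →
  signRep f (slopes a b x) ≡
  ξ ^ toℕ (f (slope a ⊙ digit x 0F Vec.∷ slope b ⊙ digit x 1F Vec.∷ Vec.[]))
signRep-slopes a b f x = cong (λ v → ξ ^ toℕ (f v)) (tabulate-cong
  (finToFun-funToFin {2} {3} (slope a ⊙ digit x 0F ∷ slope b ⊙ digit x 1F ∷ [])))

-- The substitution y = (ε₁x₁ , ε₂x₂) on a single summand: each linear correction is absorbed by the
-- character of its coordinate.
spectrum-term : ∀ a b f i x →
  C* 2 i x * signRep (transform a b f) x ≡
  C* 2 (affines a b i) (slopes a b x) * signRep f (slopes a b x)
spectrum-term a b f i x = begin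
  C* 2 i x * ξ ^ toℕ (t ⊕ linear a x₀ ⊕ linear b x₁)
    ≡⟨ C*-* i x _ ⟩
  conj (C₁ i₀ x₀) * (conj (C₁ i₁ x₁) * ξ ^ toℕ (t ⊕ linear a x₀ ⊕ linear b x₁))
    -- The second coordinate goes first because its correction is the outermost summand of the
    -- exponent.
    ≡⟨ cong (conj (C₁ i₀ x₀) *_) (character-affine b i₁ x₁ (t ⊕ linear a x₀)) ⟩
  conj (C₁ i₀ x₀) * (conj (C₁ j₁ y₁) * ξ ^ toℕ (t ⊕ linear a x₀))
    -- This brings the first character next to the power of ξ.
    ≡⟨ x∙yz≈y∙xz (conj (C₁ i₀ x₀)) (conj (C₁ j₁ y₁)) _ ⟩
  conj (C₁ j₁ y₁) * (conj (C₁ i₀ x₀) * ξ ^ toℕ (t ⊕ linear a x₀))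
    ≡⟨ cong (conj (C₁ j₁ y₁) *_) (character-affine a i₀ x₀ t) ⟩
  conj (C₁ j₁ y₁) * (conj (C₁ j₀ y₀) * ξ ^ toℕ t)
    ≡⟨ x∙yz≈y∙xz (conj (C₁ j₁ y₁)) (conj (C₁ j₀ y₀)) _ ⟩
  conj (C₁ j₀ y₀) * (conj (C₁ j₁ y₁) * ξ ^ toℕ t)
    ≡⟨ cong₂ (λ c₀ c₁ → conj c₀ * (conj c₁ * ξ ^ toℕ t))
         (cong₂ C₁ (digits-j 0F) (digits-y 0F)) (cong₂ C₁ (digits-j 1F) (digits-y 1F)) ⟨
  conj (C₁ (digit j 0F) (digit y 0F)) *
    (conj (C₁ (digit j 1F) (digit y 1F)) * ξ ^ toℕ t)
    ≡⟨ C*-* j y _ ⟨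
  C* 2 j y * ξ ^ toℕ t
    ≡⟨ cong (C* 2 j y *_) (signRep-slopes a b f x) ⟨
  C* 2 j y * signRep f y ∎
  where
  i₀ = digit i 0F
  i₁ = digit i 1F
  x₀ = digit x 0F
  x₁ = digit x 1F
  j₀ = affine a i₀
  j₁ = affine b i₁
  y₀ = slope a ⊙ x₀
  y₁ = slope b ⊙ x₁
  j y : Fin 9
  j = affines a b i
  y = slopes a b x
  t = f (y₀ Vec.∷ y₁ Vec.∷ Vec.[])
  digits-j : digit j ≗ j₀ ∷ j₁ ∷ []
  digits-j = finToFun-funToFin (j₀ ∷ j₁ ∷ [])
  digits-y : digit y ≗ y₀ ∷ y₁ ∷ []
  digits-y = finToFun-funToFin (y₀ ∷ y₁ ∷ [])

spectrum-transform : ∀ a b f →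
  spectrum (transform a b f) ≗ (γ a ⊗ γ b) ·ᵛ spectrum f
spectrum-transform a b f i = begin
  sum (λ x → C* 2 i x * signRep (transform a b f) x)
    ≡⟨ sum-cong-≗ (spectrum-term a b f i) ⟩
  sum (λ x → C* 2 (affines a b i) (slopes a b x) * signRep f (slopes a b x))
    -- Summing over y in place of x leaves an entry of the spectrum of `f`.
    ≡⟨ ∑-permute (λ y → C* 2 (affines a b i) y * signRep f y) (slopesPermutation a b) ⟨
  spectrum f (affines a b i)
    ≡⟨ permutationMatrix-·ᵛ (affines a b) (spectrum f) i ⟨
  (permutationMatrix (affines a b) ·ᵛ spectrum f) i
    ≡⟨ ·ᵛ-congʳ (γ⊗γ-isPermutation a b) (spectrum f) i ⟨
  ((γ a ⊗ γ b) ·ᵛ spectrum f) i ∎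

-- Eighteen products with different images.

-- The elements I₁, X₁, X₁ᵀ of Γ, for which ε = 1.
translation : Vector (Fin 6) 3
translation = 0F ∷ 4F ∷ 5F ∷ []

-- Reads 18 as 6 · 3: any element of `Γ` on the left, a translation on the right.
left right : Fin 18 → Fin 6
left  k = quotient 3 k
right k = translation (remainder {6} 3 k)

selected : Fin 18 → Matrix 9
selected k = γ (left k) ⊗ γ (right k)

image : Fin 9 → Fin 18 → TernaryFunction 2
image r k = transform (left k) (right k) (reference r)

image-leadsTo : ∀ r k → LeadsTo (selected k) (reference r) (image r k)
image-leadsTo r k =
  spectrum-eq⇒leadsTo (spectrum-transform (left k) (right k) (reference r))

-- Every reference function has a nonzero coefficient at x₁x₂, whose sign in the image reveals ε₁;
-- the linear coefficients then reveal c₁ and c₂. The code checks all pairs by evaluation, on value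
-- vectors, since 1, ξ, ξ² are distinct.
signRep-image-injective : ∀ r → Injective _≡_ _≗_ (λ k → signRep (image r k))
signRep-image-injective r {k} {l} = decided r k l ∘ λ eq x → ξ^-injective _ _ (eq x)
  where
  ξ^-injective : ∀ (s t : ℤ₃) → ξ ^ toℕ s ≡ ξ ^ toℕ t → s ≡ t
  ξ^-injective = toWitness {a? = all? λ s → all? λ t → _ ≟ _ →-dec _ ≟ᶠ _} _

  decided : ∀ r k l → valueVector (image r k) ≗ valueVector (image r l) → k ≡ l
  decided = toWitness
    {a? = all? λ r → all? λ k → all? λ l → all? (λ x → _ ≟ᶠ _) →-dec _ ≟ᶠ _} _

-- P determines W(2), hence G; so the matrices inherit distinctness from the images.
selected-injective : Injective _≡_ _≈ᴹ_ selected
-- `0F` picks f₁, an arbitrary choice of function on which to tell the matrices apart.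
selected-injective {k} {l} Pk≈Pl = signRep-image-injective 0F λ x → begin
  signRep (image 0F k) x
    ≡⟨ inversion (signRep (image 0F k)) x ⟨
  ⅓ ^ 2 * (C 2 ·ᵛ spectrum (image 0F k)) x
    ≡⟨ cong (⅓ ^ 2 *_) (·ᵛ-congˡ (C 2) spectra-agree x) ⟩
  ⅓ ^ 2 * (C 2 ·ᵛ spectrum (image 0F l)) x
    ≡⟨ inversion (signRep (image 0F l)) x ⟩
  signRep (image 0F l) x ∎
  where
  spectra-agree : spectrum (image 0F k) ≗ spectrum (image 0F l)
  spectra-agree i = begin
    spectrum (image 0F k) i
      ≡⟨ LeadsTo.spectrum-eq (image-leadsTo 0F k) i ⟩
    (selected k ·ᵛ spectrum f₁) i
      ≡⟨ ·ᵛ-congʳ Pk≈Pl (spectrum f₁) i ⟩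
    (selected l ·ᵛ spectrum f₁) i
      ≡⟨ LeadsTo.spectrum-eq (image-leadsTo 0F l) i ⟨
    spectrum (image 0F l) i ∎

theorem1 : ∀ (r : Fin 9) →
    Σ[ P ∈ (Fin 18 → Matrix 9) ] Σ[ g ∈ (Fin 18 → TernaryFunction 2) ]
    (∀ k → ∃[ α ] ∃[ β ] α ∈ Γ × β ∈ Γ × P k ≈ᴹ α ⊗ β)
    × Injective _≡_ _≈ᴹ_ P
    × (∀ k → LeadsTo (P k) (reference r) (g k))
    × Injective _≡_ _≗_ g
-- The same 18 matrices serve all nine reference functions.
theorem1 r = selected , image r
  , (λ k → γ (left k) , γ (right k) , ∈-lookup (left k) , ∈-lookup (right k)
         , λ i j → refl)
  , selected-injective
  , image-leadsTo r
  -- Equality on all argument vectors gives equal sign representations, by evaluation at the digits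
  -- of each `x`.
  , λ g≗h → signRep-image-injective r λ x →
      cong (λ s → ξ ^ toℕ s) (g≗h (Vec.tabulate (digit x)))
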